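{- There exists a weighted directed graph $G$ with positive edge weights and ultrametric backbone $U$ such that the union $\mathcal{S}$ of all minimum equivalent graphs of $G$ satisfies: (i) $\mathcal{S}$ lacks an edge belonging to $U$; and (ii) $\mathcal{S}$ has an edge not in $U$.
   Context: A weighted directed (distance) graph $G=(X,D)$ has node set $X$ and, for each ordered pair of nodes $(x_i,x_j)$, a weight $d_{i,j}\in[0,\infty]$. A finite value $d_{i,j}$ means that there is a directed edge from $x_i$ to $x_j$ of weight $d_{i,j}$; $d_{i,j}=\infty$ means there is no such edge. All edges therefore have finite weight, and (directed) paths use only edges. Positive edge weights means every edge has weight $>0$. The weight of a graph is the sum of the weights of its edges. The ultrametric backbone $U=(X,B^{\max})$ of $G$ is the subgraph of $G$ on the same node set $X$ whose edges are exactly the edges $(x_i,x_j)$ of $G$ (with their original weights) satisfying $d_{i,j}=d^{\mathcal U}_{i,j}$, where $d^{\mathcal U}_{i,j}=\min_{\pi}\max_{(x_k,x_l)\in\pi}d_{k,l}$, the minimum being over all directed paths $\pi$ in $G$ from $x_i$ to $x_j$. In other words, an edge $(x_i,x_j)$ of $G$ is removed if and only if there is a directed path in $G$ from $x_i$ to $x_j$ all of whose edges have weight strictly less than $d_{i,j}$. A minimum equivalent graph of $G$ is a reachability-preserving subgraph of $G$ of minimum (summed) weight. Here reachability refers only to whether or not a directed path exists from one node to another, not to the length of that path. The union of a family of subgraphs is the subgraph whose edges are those belonging to at least one of them. -}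

module Defs where

open import Data.Bool using (Bool; T; if_then_else_)
open import Data.Fin using (Fin)
open import Data.Maybe using (Maybe; Is-just; to-witness; fromMaybe)
open import Data.Nat as ℕ using (ℕ)
import Data.Nat.Properties as ℕₚ
open import Data.Product using (_×_; _,_; Σ-syntax; ∃-syntax)
open import Data.Rational as ℚ using (ℚ; 0ℚ; ½)
import Data.Rational.Properties as ℚₚ
open import Data.Vec.Functional using (foldr)
open import Function using (_⇔_)
open import Relation.Binary.Construct.Closure.ReflexiveTransitive using (Star; ε; _◅_)
open import Relation.Binary.PropositionalEquality using (_≡_; sym; trans; cong)

------------------------------------------------------------------------
-- Real numbers, as Cauchy sequences of rationals

-- The indices m and k may be exchanged, so this is ∣ s m - s k ∣ ≤ δ.
Cauchy : (ℕ → ℚ) → Set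
Cauchy s = ∀ δ → 0ℚ ℚ.< δ →
  ∃[ N ] (∀ m k → N ℕ.≤ m → N ℕ.≤ k → s m ℚ.≤ s k ℚ.+ δ)

record ℝ : Set where
  constructor mkℝ
  field
    seq    : ℕ → ℚ
    cauchy : Cauchy seq

open ℝ public

infix 4 _≤_ _<_ _≈_

_≤_ : ℝ → ℝ → Set
x ≤ y = ∀ δ → 0ℚ ℚ.< δ → ∃[ N ] (∀ m → N ℕ.≤ m → seq x m ℚ.≤ seq y m ℚ.+ δ)

_<_ : ℝ → ℝ → Set
x < y = Σ[ δ ∈ ℚ ] (0ℚ ℚ.< δ × ∃[ N ] (∀ m → N ℕ.≤ m → seq x m ℚ.+ δ ℚ.≤ seq y m))

_≈_ : ℝ → ℝ → Set
x ≈ y = x ≤ y × y ≤ x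

fromℚ : ℚ → ℝ
fromℚ q = mkℝ (λ _ → q) λ δ 0<δ → 0 , λ _ _ _ _ → begin
  q           ≡⟨ ℚₚ.+-identityʳ q ⟨
  q ℚ.+ 0ℚ    ≤⟨ ℚₚ.+-monoʳ-≤ q (ℚₚ.<⇒≤ 0<δ) ⟩
  q ℚ.+ δ     ∎
  where open ℚₚ.≤-Reasoning

0ℝ : ℝ
0ℝ = fromℚ 0ℚ

private
  halves : ∀ δ → ½ ℚ.* δ ℚ.+ ½ ℚ.* δ ≡ δ
  halves δ = trans (sym (ℚₚ.*-distribʳ-+ δ ½ ½)) (ℚₚ.*-identityˡ δ)

  interchange : ∀ a b c d → (a ℚ.+ b) ℚ.+ (c ℚ.+ d) ≡ (a ℚ.+ c) ℚ.+ (b ℚ.+ d)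
  interchange a b c d =
    trans (ℚₚ.+-assoc a b (c ℚ.+ d))
    (trans (cong (a ℚ.+_)
             (trans (sym (ℚₚ.+-assoc b c d))
             (trans (cong (ℚ._+ d) (ℚₚ.+-comm b c))
                    (ℚₚ.+-assoc c b d))))
           (sym (ℚₚ.+-assoc a c (b ℚ.+ d))))

infixl 6 _+_ _⊔_

_+_ : ℝ → ℝ → ℝ
x + y = mkℝ (λ m → seq x m ℚ.+ seq y m) λ δ 0<δ →
  let 0<½δ    = ℚₚ.*-monoʳ-<-pos ½ 0<δ
      M , x-c = cauchy x (½ ℚ.* δ) 0<½δ
      N , y-c = cauchy y (½ ℚ.* δ) 0<½δ
  in M ℕ.⊔ N , λ m k M⊔N≤m M⊔N≤k → begin
    seq x m ℚ.+ seq y m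
      ≤⟨ ℚₚ.+-mono-≤
           (x-c m k (ℕₚ.m⊔n≤o⇒m≤o M N M⊔N≤m) (ℕₚ.m⊔n≤o⇒m≤o M N M⊔N≤k))
           (y-c m k (ℕₚ.m⊔n≤o⇒n≤o M N M⊔N≤m) (ℕₚ.m⊔n≤o⇒n≤o M N M⊔N≤k)) ⟩
    (seq x k ℚ.+ ½ ℚ.* δ) ℚ.+ (seq y k ℚ.+ ½ ℚ.* δ)
      ≡⟨ interchange (seq x k) (½ ℚ.* δ) (seq y k) (½ ℚ.* δ) ⟩
    (seq x k ℚ.+ seq y k) ℚ.+ (½ ℚ.* δ ℚ.+ ½ ℚ.* δ)
      ≡⟨ cong (seq x k ℚ.+ seq y k ℚ.+_) (halves δ) ⟩
    (seq x k ℚ.+ seq y k) ℚ.+ δ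
      ∎
  where open ℚₚ.≤-Reasoning

_⊔_ : ℝ → ℝ → ℝ
x ⊔ y = mkℝ (λ m → seq x m ℚ.⊔ seq y m) λ δ 0<δ →
  let M , x-c = cauchy x δ 0<δ
      N , y-c = cauchy y δ 0<δ
  in M ℕ.⊔ N , λ m k M⊔N≤m M⊔N≤k → ℚₚ.⊔-lub
    (ℚₚ.≤-trans
      (x-c m k (ℕₚ.m⊔n≤o⇒m≤o M N M⊔N≤m) (ℕₚ.m⊔n≤o⇒m≤o M N M⊔N≤k))
      (ℚₚ.+-monoˡ-≤ δ (ℚₚ.p≤p⊔q (seq x k) (seq y k))))
    (ℚₚ.≤-trans
      (y-c m k (ℕₚ.m⊔n≤o⇒n≤o M N M⊔N≤m) (ℕₚ.m⊔n≤o⇒n≤o M N M⊔N≤k))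
      (ℚₚ.+-monoˡ-≤ δ (ℚₚ.p≤q⊔p (seq x k) (seq y k))))

sum : ∀ {n} → (Fin n → ℝ) → ℝ
sum f = foldr _+_ 0ℝ f

------------------------------------------------------------------------
-- Weighted directed graphs

-- `nothing` is the weight ∞.
record WeightedDigraph (n : ℕ) : Set where
  field
    d      : Fin n → Fin n → Maybe ℝ
    nonNeg : ∀ {i j} (e : Is-just (d i j)) → 0ℝ ≤ to-witness e

  Edge : Fin n → Fin n → Set
  Edge i j = Is-just (d i j)

  wt : ∀ {i j} → Edge i j → ℝ
  wt e = to-witness e

  PositiveWeights : Set
  PositiveWeights = ∀ {i j} (e : Edge i j) → 0ℝ < wt e

  Path : Fin n → Fin n → Set
  Path = Star Edge

  -- The trivial path gets 0, the least element of [0,∞]. As weights are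
  -- nonnegative, the final 0 does not affect the maximum over other paths.
  maxWeight : ∀ {i j} → Path i j → ℝ
  maxWeight ε       = 0ℝ
  maxWeight (e ◅ π) = wt e ⊔ maxWeight π

  -- m = min over paths π from i to j of the maximal edge weight of π
  IsUltrametricDistance : Fin n → Fin n → ℝ → Set
  IsUltrametricDistance i j m =
    (Σ[ π ∈ Path i j ] maxWeight π ≈ m) × (∀ (π : Path i j) → m ≤ maxWeight π)

  UltrametricBackbone : Fin n → Fin n → Set
  UltrametricBackbone i j = Σ[ e ∈ Edge i j ] IsUltrametricDistance i j (wt e)

  -- Subgraphs keep all the nodes and the original weights.
  record Subgraph : Set where
    field
      edges : Fin n → Fin n → Bool
      sub   : ∀ {i j} → T (edges i j) → Edge i j

    SubEdge : Fin n → Fin n → Set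
    SubEdge i j = T (edges i j)

    -- The value of fromMaybe at ∞ is never used, by `sub`.
    weight : ℝ
    weight = sum λ i → sum λ j → if edges i j then fromMaybe 0ℝ (d i j) else 0ℝ

    PreservesReachability : Set
    PreservesReachability = ∀ i j → Star SubEdge i j ⇔ Path i j

  open Subgraph

  IsMinimumEquivalentGraph : Subgraph → Set
  IsMinimumEquivalentGraph H =
    PreservesReachability H × (∀ K → PreservesReachability K → weight H ≤ weight K)

  MEGUnion : Fin n → Fin n → Set
  MEGUnion i j = Σ[ H ∈ Subgraph ] (IsMinimumEquivalentGraph H × SubEdge H i j)

{-# OPTIONS --safe #-}
module Submission where

-- The witness has three nodes a, b, c.  Its edges are a→b, b→c, c→b, b→a, all
-- of weight 2, and c→a, of weight 3.
--
--   * The edge b→a has the least weight that occurs, so it is in the backbone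
--     (`b→a∈backbone`).  The edge c→a is not: the path c→b→a uses only edges
--     of weight 2 (`c→a∉backbone`).
--
--   * The graph is strongly connected, so a subgraph preserves reachability
--     only if some edge leaves each nonempty proper set of nodes (`crossing`).
--     The sets {a} and {a,b} force a→b and b→c, the set {c} forces c→a or
--     c→b, and the set {b,c} forces c→a or b→a.  Hence a reachability-preserving
--     subgraph contains the cycle a→b→c→a, of weight 7, or the two-way path
--     a↔b↔c, of weight 8.  As weight is monotone (`weight-mono`), the cycle is
--     a minimum equivalent graph, which puts c→a in the union.
--
--   * A reachability-preserving subgraph with b→a contains the two-way path
--     or else the cycle together with b→a, of weight 9.  Either way it is
--     heavier than the cycle, so b→a is in no minimum equivalent graph.

open import Defs
open import Algebra.Bundles using (CommutativeMonoid)
import Algebra.Properties.CommutativeSemigroup as CommutativeSemigroupₚ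
open import Data.Bool using (Bool; true; false; T; if_then_else_; T?)
open import Data.Empty using (⊥-elim)
open import Data.Fin using (Fin; zero; suc)
open import Data.Fin.Patterns using (0F; 1F; 2F)
open import Data.Maybe using (Maybe; just; nothing; Is-just; to-witness; fromMaybe)
open import Data.Maybe.Relation.Unary.Any using (just)
open import Data.Nat as ℕ using (ℕ)
import Data.Nat.Properties as ℕₚ
open import Data.Product using (_×_; _,_; Σ-syntax; ∃-syntax; ∃₂)
open import Data.Rational as ℚ using (ℚ; 0ℚ; 1ℚ; ½)
import Data.Rational.Properties as ℚₚ
open import Data.Sum using (_⊎_; inj₁; inj₂)
open import Data.Unit using (tt)
open import Function using (mk⇔; Equivalence)
open import Relation.Binary.Construct.Closure.ReflexiveTransitive
  using (Star; ε; _◅_; gmap; kleisliStar)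
open import Relation.Binary.PropositionalEquality using (_≡_; refl; sym; trans; cong)
open import Relation.Nullary using (¬_; yes; no)
open import Relation.Nullary.Decidable using (toWitness)
open WeightedDigraph using (PositiveWeights; UltrametricBackbone; MEGUnion)

------------------------------------------------------------------------
-- Order and addition on the reals

private
  module ℚ+ = CommutativeSemigroupₚ
    (CommutativeMonoid.commutativeSemigroup ℚₚ.+-0-commutativeMonoid)

half-pos : ∀ {δ} → 0ℚ ℚ.< δ → 0ℚ ℚ.< ½ ℚ.* δ
half-pos = ℚₚ.*-monoʳ-<-pos ½

half+half : ∀ δ → ½ ℚ.* δ ℚ.+ ½ ℚ.* δ ≡ δ
half+half δ = trans (sym (ℚₚ.*-distribʳ-+ δ ½ ½)) (ℚₚ.*-identityˡ δ)

p≤p+δ : ∀ p {δ} → 0ℚ ℚ.< δ → p ℚ.≤ p ℚ.+ δ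
p≤p+δ p {δ} 0<δ = begin
  p           ≡⟨ ℚₚ.+-identityʳ p ⟨
  p ℚ.+ 0ℚ    ≤⟨ ℚₚ.+-monoʳ-≤ p (ℚₚ.<⇒≤ 0<δ) ⟩
  p ℚ.+ δ     ∎
  where open ℚₚ.≤-Reasoning

pointwise⇒≤ : ∀ {x y} → (∀ m → seq x m ℚ.≤ seq y m) → x ≤ y
pointwise⇒≤ {x} {y} x≤y δ 0<δ =
  0 , λ m _ → ℚₚ.≤-trans (x≤y m) (p≤p+δ (seq y m) 0<δ)

≤-refl : ∀ {x} → x ≤ x
≤-refl {x} = pointwise⇒≤ {x} {x} λ _ → ℚₚ.≤-refl

≤-trans : ∀ {x y z} → x ≤ y → y ≤ z → x ≤ z
≤-trans {x} {y} {z} x≤y y≤z δ 0<δ =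
  let M , p = x≤y (½ ℚ.* δ) (half-pos 0<δ)
      N , q = y≤z (½ ℚ.* δ) (half-pos 0<δ)
  in M ℕ.⊔ N , λ m M⊔N≤m → begin
    seq x m
      ≤⟨ p m (ℕₚ.m⊔n≤o⇒m≤o M N M⊔N≤m) ⟩
    seq y m ℚ.+ ½ ℚ.* δ
      ≤⟨ ℚₚ.+-monoˡ-≤ (½ ℚ.* δ) (q m (ℕₚ.m⊔n≤o⇒n≤o M N M⊔N≤m)) ⟩
    seq z m ℚ.+ ½ ℚ.* δ ℚ.+ ½ ℚ.* δ
      ≡⟨ ℚₚ.+-assoc (seq z m) _ _ ⟩
    seq z m ℚ.+ (½ ℚ.* δ ℚ.+ ½ ℚ.* δ)
      ≡⟨ cong (seq z m ℚ.+_) (half+half δ) ⟩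
    seq z m ℚ.+ δ
      ∎
  where open ℚₚ.≤-Reasoning

<⇒≱ : ∀ {x y} → x < y → ¬ y ≤ x
<⇒≱ {x} {y} (δ , 0<δ , M , x+δ≤y) y≤x =
  let N , y≤x+½δ = y≤x (½ ℚ.* δ) (half-pos 0<δ)
      m = M ℕ.⊔ N
  in ℚₚ.<-irrefl {seq x m ℚ.+ δ} refl (begin-strict
    seq x m ℚ.+ δ          ≤⟨ x+δ≤y m (ℕₚ.m≤m⊔n M N) ⟩
    seq y m                ≤⟨ y≤x+½δ m (ℕₚ.m≤n⊔m M N) ⟩
    seq x m ℚ.+ ½ ℚ.* δ    <⟨ ℚₚ.+-monoʳ-< (seq x m) ½δ<δ ⟩
    seq x m ℚ.+ δ          ∎)
  where
  open ℚₚ.≤-Reasoning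
  ½δ<δ : ½ ℚ.* δ ℚ.< δ
  ½δ<δ = begin-strict
    ½ ℚ.* δ                ≡⟨ ℚₚ.+-identityʳ _ ⟨
    ½ ℚ.* δ ℚ.+ 0ℚ         <⟨ ℚₚ.+-monoʳ-< (½ ℚ.* δ) (half-pos 0<δ) ⟩
    ½ ℚ.* δ ℚ.+ ½ ℚ.* δ    ≡⟨ half+half δ ⟩
    δ                      ∎

fromℚ-mono-≤ : ∀ {p q} → p ℚ.≤ q → fromℚ p ≤ fromℚ q
fromℚ-mono-≤ {p} {q} p≤q = pointwise⇒≤ {fromℚ p} {fromℚ q} λ _ → p≤q

x≤x⊔y : ∀ x y → x ≤ x ⊔ y
x≤x⊔y x y = pointwise⇒≤ {x} {x ⊔ y} λ m → ℚₚ.p≤p⊔q (seq x m) (seq y m)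

+-mono-≤ : ∀ {x x′ y y′} → x ≤ x′ → y ≤ y′ → x + y ≤ x′ + y′
+-mono-≤ {x} {x′} {y} {y′} x≤x′ y≤y′ δ 0<δ =
  let M , p = x≤x′ (½ ℚ.* δ) (half-pos 0<δ)
      N , q = y≤y′ (½ ℚ.* δ) (half-pos 0<δ)
  in M ℕ.⊔ N , λ m M⊔N≤m → begin
    seq x m ℚ.+ seq y m
      ≤⟨ ℚₚ.+-mono-≤ (p m (ℕₚ.m⊔n≤o⇒m≤o M N M⊔N≤m))
                     (q m (ℕₚ.m⊔n≤o⇒n≤o M N M⊔N≤m)) ⟩
    (seq x′ m ℚ.+ ½ ℚ.* δ) ℚ.+ (seq y′ m ℚ.+ ½ ℚ.* δ)
      ≡⟨ ℚ+.interchange (seq x′ m) (½ ℚ.* δ) (seq y′ m) (½ ℚ.* δ) ⟩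
    (seq x′ m ℚ.+ seq y′ m) ℚ.+ (½ ℚ.* δ ℚ.+ ½ ℚ.* δ)
      ≡⟨ cong (seq x′ m ℚ.+ seq y′ m ℚ.+_) (half+half δ) ⟩
    (seq x′ m ℚ.+ seq y′ m) ℚ.+ δ
      ∎
  where
  open ℚₚ.≤-Reasoning

sum-mono-≤ : ∀ {n} {f g : Fin n → ℝ} → (∀ i → f i ≤ g i) → sum f ≤ sum g
sum-mono-≤ {ℕ.zero}          f≤g = ≤-refl {0ℝ}
sum-mono-≤ {ℕ.suc n} {f} {g} f≤g =
  +-mono-≤ {f zero} {g zero} {sum (λ i → f (suc i))} {sum (λ i → g (suc i))}
    (f≤g zero) (sum-mono-≤ {n} λ i → f≤g (suc i))

------------------------------------------------------------------------
-- Cuts and subgraphs of weighted digraphs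

-- The decidable set S is a cut; the edge found is the first that leaves it.
crossing : ∀ {A : Set} {R : A → A → Set} (S : A → Bool) {i j} →
  Star R i j → T (S i) → ¬ T (S j) →
  ∃₂ λ u v → T (S u) × ¬ T (S v) × R u v
crossing S ε i∈S j∉S = ⊥-elim (j∉S i∈S)
crossing S (_◅_ {i} {k} r π) i∈S j∉S with T? (S k)
... | yes k∈S = crossing S π k∈S j∉S
... | no  k∉S = i , k , i∈S , k∉S , r

module _ {n} (G : WeightedDigraph n) where
  open WeightedDigraph G
  open Subgraph

  infix 4 _⊆_

  -- Inclusion of edge sets.
  _⊆_ : Subgraph → Subgraph → Set
  H ⊆ K = ∀ i j → SubEdge H i j → SubEdge K i j

  weight-mono : ∀ H K → H ⊆ K → weight H ≤ weight K
  weight-mono H K H⊆K =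
    sum-mono-≤ λ i → sum-mono-≤ λ j → term i j (edges H i j) (edges K i j) (H⊆K i j)
    where
    val≥0 : ∀ i j → 0ℝ ≤ fromMaybe 0ℝ (d i j)
    val≥0 i j with d i j | nonNeg {i} {j}
    ... | just _  | 0≤e = 0≤e (just tt)
    ... | nothing | _   = ≤-refl {0ℝ}

    term : ∀ i j (s t : Bool) → (T s → T t) →
      (if s then fromMaybe 0ℝ (d i j) else 0ℝ) ≤
      (if t then fromMaybe 0ℝ (d i j) else 0ℝ)
    term i j true  true  _   = ≤-refl {fromMaybe 0ℝ (d i j)}
    term i j true  false s⇒t = ⊥-elim (s⇒t tt)
    term i j false true  _   = val≥0 i j
    term i j false false _   = ≤-refl {0ℝ}

------------------------------------------------------------------------
-- The witness graph

pattern a = 0F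
pattern b = 1F
pattern c = 2F

2ℚ 3ℚ : ℚ
2ℚ = 1ℚ ℚ.+ 1ℚ
3ℚ = 2ℚ ℚ.+ 1ℚ

-- The weight 3 of c→a exceeds 2, so that c→a leaves the backbone, but is below
-- 2 + 2, so that it is cheaper than c→b and b→a together.
dist : Fin 3 → Fin 3 → Maybe ℝ
dist a b = just (fromℚ 2ℚ)
dist b c = just (fromℚ 2ℚ)
dist c b = just (fromℚ 2ℚ)
dist b a = just (fromℚ 2ℚ)
dist c a = just (fromℚ 3ℚ)
dist a a = nothing
dist a c = nothing
dist b b = nothing
dist c c = nothing

0<2 : fromℚ 0ℚ < fromℚ 2ℚ
0<2 = 2ℚ , toWitness {a? = 0ℚ ℚ.<? 2ℚ} tt , 0 , λ _ _ → ℚₚ.≤-refl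

0<3 : fromℚ 0ℚ < fromℚ 3ℚ
0<3 = 3ℚ , toWitness {a? = 0ℚ ℚ.<? 3ℚ} tt , 0 , λ _ _ → ℚₚ.≤-refl

2<3 : fromℚ 2ℚ < fromℚ 3ℚ
2<3 = 1ℚ , toWitness {a? = 0ℚ ℚ.<? 1ℚ} tt , 0 , λ _ _ → ℚₚ.≤-refl

0≤2 : fromℚ 0ℚ ≤ fromℚ 2ℚ
0≤2 = fromℚ-mono-≤ (toWitness {a? = 0ℚ ℚ.≤? 2ℚ} tt)

2≤3 : fromℚ 2ℚ ≤ fromℚ 3ℚ
2≤3 = fromℚ-mono-≤ (toWitness {a? = 2ℚ ℚ.≤? 3ℚ} tt)

0≤3 : fromℚ 0ℚ ≤ fromℚ 3ℚ
0≤3 = fromℚ-mono-≤ (toWitness {a? = 0ℚ ℚ.≤? 3ℚ} tt)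

G : WeightedDigraph 3
G = record { d = dist ; nonNeg = λ {i} {j} → nonNeg i j }
  where
  nonNeg : ∀ i j (e : Is-just (dist i j)) → 0ℝ ≤ to-witness e
  nonNeg a b (just _) = 0≤2
  nonNeg b c (just _) = 0≤2
  nonNeg c b (just _) = 0≤2
  nonNeg b a (just _) = 0≤2
  nonNeg c a (just _) = 0≤3
  nonNeg a c ()
  nonNeg c c ()

open WeightedDigraph G hiding (PositiveWeights; UltrametricBackbone; MEGUnion)
open Subgraph

positive : PositiveWeights G
positive {i} {j} = go i j
  where
  go : ∀ i j (e : Edge i j) → 0ℝ < wt e
  go a b (just _) = 0<2
  go b c (just _) = 0<2
  go c b (just _) = 0<2
  go b a (just _) = 0<2
  go c a (just _) = 0<3
  go a c ()
  go c c ()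

2≤wt : ∀ i j (e : Edge i j) → fromℚ 2ℚ ≤ wt e
2≤wt a b (just _) = ≤-refl {fromℚ 2ℚ}
2≤wt b c (just _) = ≤-refl {fromℚ 2ℚ}
2≤wt c b (just _) = ≤-refl {fromℚ 2ℚ}
2≤wt b a (just _) = ≤-refl {fromℚ 2ℚ}
2≤wt c a (just _) = 2≤3
2≤wt a c ()
2≤wt c c ()

b→a∈backbone : UltrametricBackbone G b a
b→a∈backbone =
  just tt , (just tt ◅ ε , ≤-refl {fromℚ 2ℚ} , ≤-refl {fromℚ 2ℚ}) , lower
  where
  lower : (π : Path b a) → fromℚ 2ℚ ≤ maxWeight π
  lower (_◅_ {j = k} e π) =
    ≤-trans {fromℚ 2ℚ} {wt e} {wt e ⊔ maxWeight π}
      (2≤wt b k e) (x≤x⊔y (wt e) (maxWeight π))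

c→a∉backbone : ¬ UltrametricBackbone G c a
c→a∉backbone (just _ , _ , lower) =
  <⇒≱ {fromℚ 2ℚ} {fromℚ 3ℚ} 2<3 (lower (_◅_ {j = b} (just tt) (just tt ◅ ε)))

------------------------------------------------------------------------
-- Its reachability-preserving subgraphs

-- The cycle a→b→c→a.
cycle : Subgraph
cycle = record { edges = E ; sub = λ {i} {j} → E-sub i j }
  where
  E : Fin 3 → Fin 3 → Bool
  E a b = true
  E b c = true
  E c a = true
  E _ _ = false
  E-sub : ∀ i j → T (E i j) → Edge i j
  E-sub a b _ = just tt
  E-sub b c _ = just tt
  E-sub c a _ = just tt

-- The two-way path a↔b↔c.
twoWayPath : Subgraph
twoWayPath = record { edges = E ; sub = λ {i} {j} → E-sub i j }
  where
  E : Fin 3 → Fin 3 → Bool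
  E a b = true
  E b a = true
  E b c = true
  E c b = true
  E _ _ = false
  E-sub : ∀ i j → T (E i j) → Edge i j
  E-sub a b _ = just tt
  E-sub b a _ = just tt
  E-sub b c _ = just tt
  E-sub c b _ = just tt

-- The cycle together with the edge b→a.
cycleWithChord : Subgraph
cycleWithChord = record { edges = E ; sub = λ {i} {j} → E-sub i j }
  where
  E : Fin 3 → Fin 3 → Bool
  E a b = true
  E b a = true
  E b c = true
  E c a = true
  E _ _ = false
  E-sub : ∀ i j → T (E i j) → Edge i j
  E-sub a b _ = just tt
  E-sub b a _ = just tt
  E-sub b c _ = just tt
  E-sub c a _ = just tt

cycle<twoWayPath : weight cycle < weight twoWayPath
cycle<twoWayPath = 1ℚ , toWitness {a? = 0ℚ ℚ.<? 1ℚ} tt , 0 , λ _ _ → ℚₚ.≤-refl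

cycle<cycleWithChord : weight cycle < weight cycleWithChord
cycle<cycleWithChord = 2ℚ , toWitness {a? = 0ℚ ℚ.<? 2ℚ} tt , 0 , λ _ _ → ℚₚ.≤-refl

cycle≤twoWayPath : weight cycle ≤ weight twoWayPath
cycle≤twoWayPath = pointwise⇒≤ {weight cycle} {weight twoWayPath}
  λ m → toWitness {a? = seq (weight cycle) m ℚ.≤? seq (weight twoWayPath) m} tt

-- Each edge of the graph is replaced by a path along the cycle.
cycle-preserves : PreservesReachability cycle
cycle-preserves i j =
  mk⇔ (gmap (λ k → k) λ {u} {v} → sub cycle {u} {v})
      (kleisliStar (λ k → k) λ {u} {v} → detour u v)
  where
  detour : ∀ u v → Edge u v → Star (SubEdge cycle) u v
  detour a b _ = tt ◅ ε
  detour b c _ = tt ◅ ε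
  detour c a _ = tt ◅ ε
  detour b a _ = _◅_ {j = c} tt (tt ◅ ε)
  detour c b _ = _◅_ {j = a} tt (tt ◅ ε)
  detour a c ()
  detour c c ()

module _ (K : Subgraph) (K-preserves : PreservesReachability K) where

  private
    route : ∀ i j → Path i j → Star (SubEdge K) i j
    route i j = Equivalence.from (K-preserves i j)

    a⇝b : Path a b
    a⇝b = just tt ◅ ε

    b⇝c : Path b c
    b⇝c = just tt ◅ ε

    c⇝a : Path c a
    c⇝a = just tt ◅ ε

  -- The cuts used below are {a}, {a,b}, {c} and {b,c}, in this order.
  a→b∈ : SubEdge K a b
  a→b∈ with crossing (λ { a → true ; b → false ; c → false }) (route a b a⇝b) tt (λ ())
  ... | b , _ , () , _
  ... | c , _ , () , _
  ... | a , a , _ , a∉ , _ = ⊥-elim (a∉ tt)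
  ... | a , b , _ , _ , e = e
  ... | a , c , _ , _ , e with () ← sub K {a} {c} e

  b→c∈ : SubEdge K b c
  b→c∈ with crossing (λ { a → true ; b → true ; c → false }) (route b c b⇝c) tt (λ ())
  ... | c , _ , () , _
  ... | a , a , _ , a∉ , _ = ⊥-elim (a∉ tt)
  ... | b , a , _ , a∉ , _ = ⊥-elim (a∉ tt)
  ... | a , b , _ , b∉ , _ = ⊥-elim (b∉ tt)
  ... | b , b , _ , b∉ , _ = ⊥-elim (b∉ tt)
  ... | a , c , _ , _ , e with () ← sub K {a} {c} e
  ... | b , c , _ , _ , e = e

  leaves-c : SubEdge K c a ⊎ SubEdge K c b
  leaves-c with crossing (λ { a → false ; b → false ; c → true }) (route c a c⇝a) tt (λ ())
  ... | c , a , _ , _ , e = inj₁ e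
  ... | c , b , _ , _ , e = inj₂ e
  ... | c , c , _ , c∉ , _ = ⊥-elim (c∉ tt)

  enters-a : SubEdge K c a ⊎ SubEdge K b a
  enters-a with crossing (λ { a → false ; b → true ; c → true }) (route c a c⇝a) tt (λ ())
  ... | c , a , _ , _ , e = inj₁ e
  ... | b , a , _ , _ , e = inj₂ e
  ... | b , b , _ , b∉ , _ = ⊥-elim (b∉ tt)
  ... | c , b , _ , b∉ , _ = ⊥-elim (b∉ tt)
  ... | b , c , _ , c∉ , _ = ⊥-elim (c∉ tt)
  ... | c , c , _ , c∉ , _ = ⊥-elim (c∉ tt)

  cycle⊆ : SubEdge K c a → _⊆_ G cycle K
  cycle⊆ ca a b _ = a→b∈
  cycle⊆ ca b c _ = b→c∈
  cycle⊆ ca c a _ = ca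

  twoWayPath⊆ : SubEdge K c b → SubEdge K b a → _⊆_ G twoWayPath K
  twoWayPath⊆ cb ba a b _ = a→b∈
  twoWayPath⊆ cb ba b a _ = ba
  twoWayPath⊆ cb ba b c _ = b→c∈
  twoWayPath⊆ cb ba c b _ = cb

  cycleWithChord⊆ : SubEdge K c a → SubEdge K b a → _⊆_ G cycleWithChord K
  cycleWithChord⊆ ca ba a b _ = a→b∈
  cycleWithChord⊆ ca ba b a _ = ba
  cycleWithChord⊆ ca ba b c _ = b→c∈
  cycleWithChord⊆ ca ba c a _ = ca

  cycle-lightest : weight cycle ≤ weight K
  cycle-lightest with leaves-c | enters-a
  ... | inj₁ ca | _       = weight-mono G cycle K (cycle⊆ ca)
  ... | inj₂ _  | inj₁ ca = weight-mono G cycle K (cycle⊆ ca)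
  ... | inj₂ cb | inj₂ ba =
    ≤-trans {weight cycle} {weight twoWayPath} {weight K}
      cycle≤twoWayPath (weight-mono G twoWayPath K (twoWayPath⊆ cb ba))

  b→a-too-heavy : SubEdge K b a → ¬ weight K ≤ weight cycle
  b→a-too-heavy ba K≤cycle with leaves-c
  ... | inj₁ ca = <⇒≱ {weight cycle} {weight cycleWithChord} cycle<cycleWithChord
    (≤-trans {weight cycleWithChord} {weight K} {weight cycle}
      (weight-mono G cycleWithChord K (cycleWithChord⊆ ca ba)) K≤cycle)
  ... | inj₂ cb = <⇒≱ {weight cycle} {weight twoWayPath} cycle<twoWayPath
    (≤-trans {weight twoWayPath} {weight K} {weight cycle}
      (weight-mono G twoWayPath K (twoWayPath⊆ cb ba)) K≤cycle)

b→a∉MEGUnion : ¬ MEGUnion G b a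
b→a∉MEGUnion (H , (H-preserves , H-lightest) , ba) =
  b→a-too-heavy H H-preserves ba (H-lightest cycle cycle-preserves)

c→a∈MEGUnion : MEGUnion G c a
c→a∈MEGUnion = cycle , (cycle-preserves , cycle-lightest) , tt

mainTheorem3 : ∃[ n ] Σ[ G ∈ WeightedDigraph n ]
    ( PositiveWeights G
    × (∃₂ λ i j → UltrametricBackbone G i j × ¬ MEGUnion G i j)
    × (∃₂ λ i j → MEGUnion G i j × ¬ UltrametricBackbone G i j) )
mainTheorem3 = 3 , G , positive
  , (b , a , b→a∈backbone , b→a∉MEGUnion)
  , (c , a , c→a∈MEGUnion , c→a∉backbone)
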